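{- Let $p$ be an odd prime, $1\le m\le n$, and let $I=A\cup B$ be a generalized order ideal of $\mathbb{GH}(m,n)$, of saturated or unsaturated type, all of whose multiplicities lie in $\{0,p-1\}$, where $A$ is the part of $I$ on $[m]$ and $B$ the part of $I$ on $[n]\setminus[m]$, with supports $\bar A\subseteq[m]$ and $\bar B\subseteq[n]\setminus[m]$. Let $f:\mathbb{F}_p^n\to\mathbb{F}_p$ be the characteristic function of $I(\mathbb{GP})\setminus\{0\}$ and \[ \mathcal{C}_f=\{(sf(x)+u\cdot x)_{x\in\mathbb{F}_p^n\setminus0}:\ s\in\mathbb{F}_p,\ u\in\mathbb{F}_p^n\}. \] If $\bar A\cup\bar B\ne[n]$, then $\mathcal{C}_f$ is not minimal.
   Context: $[n]=\{1,\dots,n\}$; $u\cdot x=\sum_i u_ix_i$. The support $\mathrm{supp}(c)$ of a codeword $c$ is the set of positions where it is nonzero. A nonzero codeword $c$ of a linear code $\mathcal{C}$ over $\mathbb{F}_p$ is minimal if $c'\in\mathcal{C}$ and $\mathrm{supp}(c')\subseteq\mathrm{supp}(c)$ imply $c'\in\mathbb{F}_pc$; $\mathcal{C}$ is minimal if all its nonzero codewords are. Generalized order ideals: $[n]_{p-1}$ is the multiset in which each $i\in[n]$ has multiplicity $p-1$. A sub-multiset $J$ is identified with its multiplicity vector $(J_1,\dots,J_n)\in\{0,\dots,p-1\}^n$, regarded as a vector of $\mathbb{F}_p^n$; $J\subseteq J'$ means $J_i\le J'_i$ (as integers) for all $i$; $\bar J=\{i:J_i\ne0\}$. The hierarchical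 poset $\mathbb{H}(m,n)$ on $[n]$ has as its only strict relations $i\prec j$ for all $i\in[m]$, $j\in[n]\setminus[m]$; $\mathbb{GH}(m,n)$ denotes $[n]_{p-1}$ together with this order. $J$ is an unsaturated generalized order ideal if $\bar J$ is an order ideal (down-closed subset) of $\mathbb{H}(m,n)$; it is a saturated generalized order ideal if moreover $J_i=p-1$ whenever $j\in\bar J$ and $i\prec j$. For a generalized order ideal $I$ of either type, $I(\mathbb{GP})\subseteq\mathbb{F}_p^n$ is the set of all generalized order ideals of the same type contained in $I$.
   Formalization: The ideal I is additionally assumed to be nonempty (not the zero multiset): for empty I the function f is zero and the code consists of the words (u·x), which is minimal, so the claim fails there. -}

module Defs where

open import Level using (0ℓ)
open import Data.Bool using (if_then_else_)
open import Data.Fin as Fin using (Fin; toℕ)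
open import Data.Fin.Properties using (all?)
open import Data.Nat as ℕ using (ℕ; NonZero; _∸_)
open import Data.Nat.DivMod using (_mod_)
open import Data.Product using (_×_; ∃; ∃-syntax; proj₁)
open import Data.Vec using (Vec; lookup; tabulate; replicate; zipWith; foldr′)
open import Data.Vec.Properties using (≡-dec)
open import Relation.Binary using (Rel)
open import Relation.Binary.PropositionalEquality using (_≡_; _≢_)
open import Relation.Nullary using (Dec; does; ¬_; ¬?; _×-dec_; _→-dec_)
open import Relation.Unary using (Pred; Decidable; _∈_; _⊆_; _∖_; ｛_｝)

-- For p prime, residues mod p are the field 𝔽ₚ.  The operations below only
-- need p ≠ 0; primality is assumed in the theorem.
𝔽 : ℕ → Set
𝔽 p = Fin p

module _ {p : ℕ} .{{_ : NonZero p}} where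

  infixl 6 _+_
  infixl 7 _*_ _·_

  0𝔽 1𝔽 : 𝔽 p
  0𝔽 = 0 mod p
  1𝔽 = 1 mod p

  _+_ _*_ : 𝔽 p → 𝔽 p → 𝔽 p
  a + b = (toℕ a ℕ.+ toℕ b) mod p
  a * b = (toℕ a ℕ.* toℕ b) mod p

  𝟎 : ∀ {n} → Vec (𝔽 p) n
  𝟎 = replicate _ 0𝔽

  _·_ : ∀ {n} → Vec (𝔽 p) n → Vec (𝔽 p) n → 𝔽 p
  u · x = foldr′ _+_ 0𝔽 (zipWith _*_ u x)

  supp : {X : Set} → (X → 𝔽 p) → Pred X 0ℓ
  supp c x = c x ≢ 0𝔽

  -- A word with positions in X is a function X → 𝔽 p, and a code is a predicate
  -- on words.  Words are compared pointwise.

  module _ {X : Set} where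

    NonzeroWord : Pred (X → 𝔽 p) 0ℓ
    NonzeroWord c = ¬ (∀ x → c x ≡ 0𝔽)

    MinimalCodeword : Pred (X → 𝔽 p) 0ℓ → Pred (X → 𝔽 p) 0ℓ
    MinimalCodeword C c =
      c ∈ C × NonzeroWord c ×
      (∀ c′ → c′ ∈ C → supp c′ ⊆ supp c → ∃[ a ] (∀ x → c′ x ≡ a * c x))

    MinimalCode : Pred (Pred (X → 𝔽 p) 0ℓ) 0ℓ
    MinimalCode C = ∀ c → c ∈ C → NonzeroWord c → MinimalCodeword C c

  Nonzero𝔽^ : ℕ → Set
  Nonzero𝔽^ n = ∃ λ (x : Vec (𝔽 p) n) → x ≢ 𝟎

  𝒞 : ∀ {n} → (Vec (𝔽 p) n → 𝔽 p) → Pred (Nonzero𝔽^ n → 𝔽 p) 0ℓ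
  𝒞 f c = ∃[ s ] ∃[ u ] (∀ x → c x ≡ s * f (proj₁ x) + u · proj₁ x)

  characteristic : ∀ {n} {S : Pred (Vec (𝔽 p) n) 0ℓ} →
                   Decidable S → Vec (𝔽 p) n → 𝔽 p
  characteristic S? x = if does (S? x) then 1𝔽 else 0𝔽

-- Indices in Fin n start at 0, so toℕ i < m says that i lies in [m].

Hierarchical : ∀ m {n} → Rel (Fin n) 0ℓ
Hierarchical m i j = toℕ i ℕ.< m × m ℕ.≤ toℕ j

infix 4 _≺[_]_
_≺[_]_ : ∀ {n} → Fin n → ℕ → Fin n → Set
i ≺[ m ] j = Hierarchical m i j

IsOrderIdeal : ∀ {n} → ℕ → Pred (Pred (Fin n) 0ℓ) 0ℓ
IsOrderIdeal m S = ∀ i j → j ∈ S → i ≺[ m ] j → i ∈ S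

data IdealType : Set where
  unsaturated saturated : IdealType

-- A sub-multiset of [n]ₚ₋₁ is its multiplicity vector in Vec (𝔽 p) n, where toℕ
-- recovers the multiplicity.

module _ {p : ℕ} .{{_ : NonZero p}} where

  bar : ∀ {n} → Vec (𝔽 p) n → Pred (Fin n) 0ℓ
  bar J = supp (lookup J)

  infix 4 _⊑_
  _⊑_ : ∀ {n} → Rel (Vec (𝔽 p) n) 0ℓ
  J ⊑ J′ = ∀ i → toℕ (lookup J i) ℕ.≤ toℕ (lookup J′ i)

  IsGenOrderIdeal : ∀ {n} → IdealType → ℕ → Pred (Vec (𝔽 p) n) 0ℓ
  IsGenOrderIdeal unsaturated m J = IsOrderIdeal m (bar J)
  IsGenOrderIdeal saturated   m J =
    IsOrderIdeal m (bar J) ×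
    (∀ i j → j ∈ bar J → i ≺[ m ] j → toℕ (lookup J i) ≡ p ∸ 1)

  IdealsIn : ∀ {n} → IdealType → ℕ → Vec (𝔽 p) n → Pred (Vec (𝔽 p) n) 0ℓ
  IdealsIn t m I J = IsGenOrderIdeal t m J × J ⊑ I

  lowerPart upperPart : ∀ {n} → ℕ → Vec (𝔽 p) n → Vec (𝔽 p) n
  lowerPart m I = tabulate λ i → if does (toℕ i ℕ.<? m) then lookup I i else 0𝔽
  upperPart m I = tabulate λ i → if does (m ℕ.≤? toℕ i) then lookup I i else 0𝔽

  bar? : ∀ {n} (J : Vec (𝔽 p) n) → Decidable (bar J)
  bar? J i = ¬? (lookup J i Fin.≟ 0𝔽)

  ≺? : ∀ {n} m (i j : Fin n) → Dec (i ≺[ m ] j)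
  ≺? m i j = (toℕ i ℕ.<? m) ×-dec (m ℕ.≤? toℕ j)

  isOrderIdeal-bar? : ∀ {n} m (J : Vec (𝔽 p) n) → Dec (IsOrderIdeal m (bar J))
  isOrderIdeal-bar? m J =
    all? λ i → all? λ j → bar? J j →-dec (≺? m i j →-dec bar? J i)

  isGenOrderIdeal? : ∀ {n} t m → Decidable (IsGenOrderIdeal {n} t m)
  isGenOrderIdeal? unsaturated m J = isOrderIdeal-bar? m J
  isGenOrderIdeal? saturated   m J =
    isOrderIdeal-bar? m J ×-dec
    (all? λ i → all? λ j →
      bar? J j →-dec (≺? m i j →-dec (toℕ (lookup J i) ℕ.≟ p ∸ 1)))

  IdealsIn∖𝟎? : ∀ {n} t m (I : Vec (𝔽 p) n) → Decidable (IdealsIn t m I ∖ ｛ 𝟎 ｝)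
  IdealsIn∖𝟎? t m I J =
    (isGenOrderIdeal? t m J ×-dec
      (all? λ i → toℕ (lookup J i) ℕ.≤? toℕ (lookup I i)))
    ×-dec ¬? (≡-dec Fin._≟_ 𝟎 J)

  idealFunction : ∀ {n} → IdealType → ℕ → Vec (𝔽 p) n → Vec (𝔽 p) n → 𝔽 p
  idealFunction t m I = characteristic (IdealsIn∖𝟎? t m I)

{-# OPTIONS --safe #-}
module Submission where

-- Let k be a coordinate with Iₖ = 0.  Every generalized order ideal contained
-- in I vanishes at k, so f(x) = 0 whenever xₖ ≠ 0.  Compare the codewords
-- c = (f(x) + xₖ)ₓ and c′ = (xₖ)ₓ.  Where xₖ ≠ 0 both take the value xₖ, hence
-- supp c′ ⊆ supp c.  If c′ = a c, evaluating at the unit vector eₖ gives a = 1,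
-- so that f vanishes at every nonzero x.  But f(I) = 1, since I is a nonzero
-- ideal contained in itself.  So c is a nonzero codeword that is not minimal.
--
-- not-minimal carries this argument for any f vanishing where xₖ ≠ 0;
-- proposition5p2 checks its hypotheses for the function of an ideal.

open import Defs
open import Level using (0ℓ)
open import Data.Bool using (if_then_else_)
open import Data.Empty using (⊥-elim)
open import Data.Fin as Fin using (Fin; toℕ)
open import Data.Fin.Properties using (toℕ-fromℕ<; toℕ-injective; toℕ<n; any?)
open import Data.Nat as ℕ using (ℕ; NonZero; _≤_; _∸_; _%_)
open import Data.Nat.Divisibility using (_∣_)
open import Data.Nat.DivMod using (_mod_; m%n<n; m<n⇒m%n≡m)
open import Data.Nat.Primality using (Prime; prime⇒nonTrivial)
import Data.Nat.Properties as ℕₚ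
open import Data.Product using (_,_; ∃-syntax; proj₁; proj₂)
open import Data.Sum using (_⊎_; inj₁; inj₂)
open import Data.Vec using (Vec; []; _∷_; lookup; _[_]≔_)
open import Data.Vec.Properties
  using (lookup∘tabulate; lookup∘updateAt; lookup-replicate)
open import Relation.Binary.PropositionalEquality
  using (_≡_; _≢_; refl; sym; trans; cong; cong₂; subst; module ≡-Reasoning)
open import Relation.Nullary using (yes; no; does; ¬_)
open import Relation.Nullary.Decidable using (dec-true; dec-false)
open import Relation.Unary using (Pred; Decidable; _∈_; _∉_; _∪_; _≐_; U)

open ≡-Reasoning

module _ {p : ℕ} .{{_ : NonZero p}} where

  toℕ-mod : ∀ a → toℕ (a mod p) ≡ a % p
  toℕ-mod a = toℕ-fromℕ< (m%n<n a p)

  mod-toℕ : (a : 𝔽 p) → toℕ a mod p ≡ a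
  mod-toℕ a = toℕ-injective (trans (toℕ-mod (toℕ a)) (m<n⇒m%n≡m (toℕ<n a)))

  toℕ-0𝔽 : toℕ (0𝔽 {p}) ≡ 0
  toℕ-0𝔽 = trans (toℕ-mod 0) (m<n⇒m%n≡m (ℕ.>-nonZero⁻¹ p))

  +-identityˡ : (a : 𝔽 p) → 0𝔽 + a ≡ a
  +-identityˡ a = trans (cong (λ z → (z ℕ.+ toℕ a) mod p) toℕ-0𝔽) (mod-toℕ a)

  +-identityʳ : (a : 𝔽 p) → a + 0𝔽 ≡ a
  +-identityʳ a = begin
    (toℕ a ℕ.+ toℕ 0𝔽) mod p  ≡⟨ cong (λ z → (toℕ a ℕ.+ z) mod p) toℕ-0𝔽 ⟩
    (toℕ a ℕ.+ 0) mod p       ≡⟨ cong (_mod p) (ℕₚ.+-identityʳ (toℕ a)) ⟩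
    toℕ a mod p               ≡⟨ mod-toℕ a ⟩
    a                         ∎

  *-zeroˡ : (a : 𝔽 p) → 0𝔽 * a ≡ 0𝔽
  *-zeroˡ a = cong (λ z → (z ℕ.* toℕ a) mod p) toℕ-0𝔽

  𝟎·x≡0 : ∀ {n} (x : Vec (𝔽 p) n) → 𝟎 · x ≡ 0𝔽
  𝟎·x≡0 []      = refl
  𝟎·x≡0 (a ∷ x) = trans (cong₂ _+_ (*-zeroˡ a) (𝟎·x≡0 x)) (+-identityˡ 0𝔽)

  -- The k-th unit vector.
  e : ∀ {n} → Fin n → Vec (𝔽 p) n
  e k = 𝟎 [ k ]≔ 1𝔽

  lookup-e : ∀ {n} (k : Fin n) → lookup (e k) k ≡ 1𝔽
  lookup-e k = lookup∘updateAt k 𝟎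

  module _ (1<p : 1 ℕ.< p) where

    toℕ-1𝔽 : toℕ (1𝔽 {p}) ≡ 1
    toℕ-1𝔽 = trans (toℕ-mod 1) (m<n⇒m%n≡m 1<p)

    1≢0 : 1𝔽 {p} ≢ 0𝔽
    1≢0 eq with trans (sym toℕ-1𝔽) (trans (cong toℕ eq) toℕ-0𝔽)
    ... | ()

    *-identityˡ : (a : 𝔽 p) → 1𝔽 * a ≡ a
    *-identityˡ a = begin
      (toℕ 1𝔽 ℕ.* toℕ a) mod p  ≡⟨ cong (λ z → (z ℕ.* toℕ a) mod p) toℕ-1𝔽 ⟩
      (1 ℕ.* toℕ a) mod p       ≡⟨ cong (_mod p) (ℕₚ.*-identityˡ (toℕ a)) ⟩
      toℕ a mod p               ≡⟨ mod-toℕ a ⟩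
      a                         ∎

    *-identityʳ : (a : 𝔽 p) → a * 1𝔽 ≡ a
    *-identityʳ a =
      trans (cong (_mod p) (ℕₚ.*-comm (toℕ a) (toℕ 1𝔽))) (*-identityˡ a)

    e·x≡lookup : ∀ {n} (k : Fin n) (x : Vec (𝔽 p) n) → e k · x ≡ lookup x k
    e·x≡lookup Fin.zero    (a ∷ x) =
      trans (cong₂ _+_ (*-identityˡ a) (𝟎·x≡0 x)) (+-identityʳ a)
    e·x≡lookup (Fin.suc k) (a ∷ x) =
      trans (cong₂ _+_ (*-zeroˡ a) (e·x≡lookup k x)) (+-identityˡ (lookup x k))

    e≢𝟎 : ∀ {n} (k : Fin n) → e k ≢ 𝟎
    e≢𝟎 k eq = 1≢0 (begin
      1𝔽              ≡⟨ lookup-e k ⟨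
      lookup (e k) k  ≡⟨ cong (λ x → lookup x k) eq ⟩
      lookup 𝟎 k      ≡⟨ lookup-replicate k 0𝔽 ⟩
      0𝔽              ∎)

    -- If f lives on the hyperplane xₖ = 0 and is nonzero at some z ≠ 0, then
    -- the codeword f(x) + xₖ covers xₖ without being proportional to it.
    not-minimal : ∀ {n} (f : Vec (𝔽 p) n → 𝔽 p) (k : Fin n) →
                  (∀ x → lookup x k ≢ 0𝔽 → f x ≡ 0𝔽) →
                  (z : Nonzero𝔽^ n) → lookup (proj₁ z) k ≡ 0𝔽 →
                  f (proj₁ z) ≢ 0𝔽 →
                  ¬ MinimalCode (𝒞 f)
    not-minimal {n} f k f≡0 z zₖ≡0 fz≢0 minimal = fz≢0 (begin
      f (proj₁ z)                          ≡⟨ +-identityʳ _ ⟨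
      f (proj₁ z) + 0𝔽                     ≡⟨ cong (f (proj₁ z) +_) zₖ≡0 ⟨
      f (proj₁ z) + lookup (proj₁ z) k     ≡⟨ c-value z ⟨
      c z                                  ≡⟨ *-identityˡ (c z) ⟨
      1𝔽 * c z                             ≡⟨ cong (_* c z) a≡1 ⟨
      a * c z                              ≡⟨ c′≡ac z ⟨
      c′ z                                 ≡⟨ c′-value z ⟩
      lookup (proj₁ z) k                   ≡⟨ zₖ≡0 ⟩
      0𝔽                                   ∎)
      where
      c c′ : Nonzero𝔽^ n → 𝔽 p
      c  x = 1𝔽 * f (proj₁ x) + e k · proj₁ x
      c′ x = 0𝔽 * f (proj₁ x) + e k · proj₁ x

      c-value : ∀ x → c x ≡ f (proj₁ x) + lookup (proj₁ x) k
      c-value (x , _) = cong₂ _+_ (*-identityˡ (f x)) (e·x≡lookup k x)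

      c′-value : ∀ x → c′ x ≡ lookup (proj₁ x) k
      c′-value (x , _) =
        trans (cong₂ _+_ (*-zeroˡ (f x)) (e·x≡lookup k x)) (+-identityˡ _)

      c-off-hyperplane : ∀ x → lookup (proj₁ x) k ≢ 0𝔽 → c x ≡ lookup (proj₁ x) k
      c-off-hyperplane x xₖ≢0 =
        trans (c-value x)
          (trans (cong (_+ lookup (proj₁ x) k) (f≡0 (proj₁ x) xₖ≢0)) (+-identityˡ _))

      eₖ : Nonzero𝔽^ n
      eₖ = e k , e≢𝟎 k

      c-eₖ : c eₖ ≡ 1𝔽
      c-eₖ = trans (c-off-hyperplane eₖ (λ eq → 1≢0 (trans (sym (lookup-e k)) eq)))
                   (lookup-e k)

      supp-c′⊆supp-c : ∀ {x} → c′ x ≢ 0𝔽 → c x ≢ 0𝔽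
      supp-c′⊆supp-c {x} c′x≢0 cx≡0 = xₖ≢0 (trans (sym (c-off-hyperplane x xₖ≢0)) cx≡0)
        where
        xₖ≢0 : lookup (proj₁ x) k ≢ 0𝔽
        xₖ≢0 eq = c′x≢0 (trans (c′-value x) eq)

      proportional : ∃[ a ] (∀ x → c′ x ≡ a * c x)
      proportional =
        proj₂ (proj₂ (minimal c (1𝔽 , e k , λ _ → refl)
                                (λ c≡0 → 1≢0 (trans (sym c-eₖ) (c≡0 eₖ)))))
          c′ (0𝔽 , e k , λ _ → refl) (λ {x} → supp-c′⊆supp-c {x})

      a : 𝔽 p
      a = proj₁ proportional

      c′≡ac : ∀ x → c′ x ≡ a * c x
      c′≡ac = proj₂ proportional

      a≡1 : a ≡ 1𝔽
      a≡1 = begin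
        a               ≡⟨ *-identityʳ a ⟨
        a * 1𝔽          ≡⟨ cong (a *_) c-eₖ ⟨
        a * c eₖ        ≡⟨ c′≡ac eₖ ⟨
        c′ eₖ           ≡⟨ c′-value eₖ ⟩
        lookup (e k) k  ≡⟨ lookup-e k ⟩
        1𝔽              ∎

  characteristic-∈ : ∀ {n} {S : Pred (Vec (𝔽 p) n) 0ℓ} (S? : Decidable S) {x} →
                     x ∈ S → characteristic S? x ≡ 1𝔽
  characteristic-∈ S? {x} x∈S =
    cong (λ b → if b then 1𝔽 else 0𝔽) (dec-true (S? x) x∈S)

  characteristic-∉ : ∀ {n} {S : Pred (Vec (𝔽 p) n) 0ℓ} (S? : Decidable S) {x} →
                     x ∉ S → characteristic S? x ≡ 0𝔽
  characteristic-∉ S? {x} x∉S =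
    cong (λ b → if b then 1𝔽 else 0𝔽) (dec-false (S? x) x∉S)

  ⊑-zero : ∀ {n} {J J′ : Vec (𝔽 p) n} → J ⊑ J′ →
           ∀ k → lookup J′ k ≡ 0𝔽 → lookup J k ≡ 0𝔽
  ⊑-zero {J = J} J⊑J′ k J′ₖ≡0 = toℕ-injective (trans toℕJₖ≡0 (sym toℕ-0𝔽))
    where
    toℕJₖ≡0 : toℕ (lookup J k) ≡ 0
    toℕJₖ≡0 = ℕₚ.n≤0⇒n≡0 (subst (toℕ (lookup J k) ≤_)
                                (trans (cong toℕ J′ₖ≡0) toℕ-0𝔽) (J⊑J′ k))

  bar⊆parts : ∀ {n} m (I : Vec (𝔽 p) n) {i} → i ∈ bar I →
              i ∈ bar (lowerPart m I) ∪ bar (upperPart m I)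
  bar⊆parts m I {i} Iᵢ≢0 = split (ℕₚ.<-≤-connex (toℕ i) m)
    where
    split : toℕ i ℕ.< m ⊎ m ≤ toℕ i →
            i ∈ bar (lowerPart m I) ∪ bar (upperPart m I)
    split (inj₁ i<m) = inj₁ λ eq → Iᵢ≢0 (begin
      lookup I i
        ≡⟨ cong (λ b → if b then lookup I i else 0𝔽) (dec-true (toℕ i ℕ.<? m) i<m) ⟨
      (if does (toℕ i ℕ.<? m) then lookup I i else 0𝔽)
        ≡⟨ lookup∘tabulate _ i ⟨
      lookup (lowerPart m I) i
        ≡⟨ eq ⟩
      0𝔽 ∎)
    split (inj₂ m≤i) = inj₂ λ eq → Iᵢ≢0 (begin
      lookup I i
        ≡⟨ cong (λ b → if b then lookup I i else 0𝔽) (dec-true (m ℕ.≤? toℕ i) m≤i) ⟨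
      (if does (m ℕ.≤? toℕ i) then lookup I i else 0𝔽)
        ≡⟨ lookup∘tabulate _ i ⟨
      lookup (upperPart m I) i
        ≡⟨ eq ⟩
      0𝔽 ∎)

  -- Equality in 𝔽 p is decidable, so the missing coordinate is found by search.
  zero-coordinate : ∀ {n} m (I : Vec (𝔽 p) n) →
                    ¬ (bar (lowerPart m I) ∪ bar (upperPart m I) ≐ U) →
                    ∃[ k ] lookup I k ≡ 0𝔽
  zero-coordinate m I parts≢U with any? (λ k → lookup I k Fin.≟ 0𝔽)
  ... | yes found = found
  ... | no  none  =
    ⊥-elim (parts≢U (_ , λ {i} _ → bar⊆parts m I (λ Iᵢ≡0 → none (i , Iᵢ≡0))))

proposition5p2 : (p : ℕ) .{{_ : NonZero p}} → Prime p → ¬ (2 ∣ p) →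
    (m n : ℕ) → 1 ≤ m → m ≤ n →
    (t : IdealType) (I : Vec (𝔽 p) n) →
    IsGenOrderIdeal t m I →
    (∀ (i : Fin n) → toℕ (lookup I i) ≡ 0 ⊎ toℕ (lookup I i) ≡ p ∸ 1) →
    I ≢ 𝟎 →
    ¬ (bar (lowerPart m I) ∪ bar (upperPart m I) ≐ U) →
    ¬ MinimalCode (𝒞 (idealFunction t m I))
proposition5p2 p p-prime _ m n _ _ t I I-ideal _ I≢𝟎 parts≢U =
  not-minimal 1<p (idealFunction t m I) k f≡0 (I , I≢𝟎) Iₖ≡0 fI≢0
  where
  1<p : 1 ℕ.< p
  1<p = ℕ.nonTrivial⇒n>1 p {{prime⇒nonTrivial p-prime}}

  k : Fin n
  k = proj₁ (zero-coordinate m I parts≢U)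

  Iₖ≡0 : lookup I k ≡ 0𝔽
  Iₖ≡0 = proj₂ (zero-coordinate m I parts≢U)

  f≡0 : ∀ x → lookup x k ≢ 0𝔽 → idealFunction t m I x ≡ 0𝔽
  f≡0 x xₖ≢0 = characteristic-∉ (IdealsIn∖𝟎? t m I)
    λ { ((_ , x⊑I) , _) → xₖ≢0 (⊑-zero {J = x} {J′ = I} x⊑I k Iₖ≡0) }

  fI≢0 : idealFunction t m I I ≢ 0𝔽
  fI≢0 eq = 1≢0 1<p (trans (sym (characteristic-∈ (IdealsIn∖𝟎? t m I) I∈S)) eq)
    where
    I∈S = (I-ideal , λ _ → ℕₚ.≤-refl) , λ 𝟎≡I → I≢𝟎 (sym 𝟎≡I)
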